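{- Let $(W,S)$ be a Coxeter group and $u\in W$. The sets $[e,u]_L=\{w\in W\mid w\le_L u\}$ and $[e,u]_R=\{w\in W\mid w\le_R u\}$ have the Chain Property: for any $v,w$ in the set with $v\le w$, there is a chain $v=x_0\lessdot x_1\lessdot\cdots\lessdot x_n=w$ of strong covers with every $x_i$ in the set.
   Context: $\le$ is the strong (Bruhat) order, $l$ the length, $\le_L$ the left weak order ($u\le_L v$ iff $l(vu^{ -1})+l(u)=l(v)$) and $\le_R$ the right weak order ($u\le_R v$ iff $l(u)+l(u^{ -1}v)=l(v)$). $a\lessdot b$ means $a<b$ and $l(b)=l(a)+1$. -}

module Defs where

open import Level using (Level; _⊔_) renaming (suc to lsuc)
open import Algebra.Bundles using (Group)
open import Algebra.Morphism.Structures using (module GroupMorphisms)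
open import Data.Nat using (ℕ; zero; suc; _+_; _<_; _≤_)
open import Data.List using (List; []; _∷_; foldr; length)
open import Data.Product using (Σ; ∃; _×_; _,_)
open import Relation.Binary.PropositionalEquality using (_≡_; _≢_)
open import Relation.Nullary using (¬_)

pow : ∀ {c ℓ} (G : Group c ℓ) → Group.Carrier G → ℕ → Group.Carrier G
pow G x zero = Group.ε G
pow G x (suc n) = Group._∙_ G x (pow G x n)

-- A Coxeter system (W,S): W is the group given by the Coxeter presentation
-- ⟨ s_i (i ∈ I) ∣ (s_i s_j)^{m(i,j)} = 1 whenever m(i,j) ≠ ∞ ⟩,
-- where m is a Coxeter matrix (m(i,i)=1, m symmetric, m(i,j) ∈ {2,3,…,∞} for i≠j;
-- the value ∞ is encoded as 0).  "W is presented by these generators and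
-- relations" is expressed by: the generators satisfy the relations, they
-- generate W, and W has the universal property of the presentation.
record CoxeterSystem (c ℓ i : Level) : Set (lsuc (c ⊔ ℓ ⊔ i)) where
  field
    W : Group c ℓ
    I : Set i
    m : I → I → ℕ
  open Group W
  field
    gen : I → Carrier
    m-diag : ∀ a → m a a ≡ 1
    m-sym : ∀ a b → m a b ≡ m b a
    m-off : ∀ a b → a ≢ b → m a b ≢ 1
    rel : ∀ a b → m a b ≢ 0 → pow W (gen a ∙ gen b) (m a b) ≈ ε
  prod : List I → Carrier
  prod = foldr (λ a x → gen a ∙ x) ε
  field
    generated : ∀ w → ∃ λ (ws : List I) → prod ws ≈ w
    universal : (G : Group c ℓ) (f : I → Group.Carrier G) →
      (∀ a b → m a b ≢ 0 →
         Group._≈_ G (pow G (Group._∙_ G (f a) (f b)) (m a b)) (Group.ε G)) →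
      ∃ λ (h : Carrier → Group.Carrier G) →
        GroupMorphisms.IsGroupHomomorphism (Group.rawGroup W) (Group.rawGroup G) h
        × (∀ a → Group._≈_ G (h (gen a)) (f a))

module CoxeterNotions {c ℓ i : Level} (CS : CoxeterSystem c ℓ i) where
  open CoxeterSystem CS
  open Group W

  Len : Carrier → ℕ → Set (ℓ ⊔ i)
  Len w n = (∃ λ (ws : List I) → prod ws ≈ w × length ws ≡ n)
          × (∀ (ws : List I) → prod ws ≈ w → n ≤ length ws)

  _≤L_ : Carrier → Carrier → Set (ℓ ⊔ i)
  u ≤L v = ∃ λ a → ∃ λ b → ∃ λ d →
    Len (v ∙ u ⁻¹) a × Len u b × Len v d × a + b ≡ d

  _≤R_ : Carrier → Carrier → Set (ℓ ⊔ i)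
  u ≤R v = ∃ λ a → ∃ λ b → ∃ λ d →
    Len u a × Len (u ⁻¹ ∙ v) b × Len v d × a + b ≡ d

  IsReflection : Carrier → Set (c ⊔ ℓ ⊔ i)
  IsReflection t = ∃ λ (w : Carrier) → ∃ λ (a : I) → t ≈ w ∙ gen a ∙ w ⁻¹

  Arrow : Carrier → Carrier → Set (c ⊔ ℓ ⊔ i)
  Arrow u w = ∃ λ t → IsReflection t × w ≈ u ∙ t ×
    ∃ λ a → ∃ λ b → Len u a × Len w b × a < b

  data _≤B_ : Carrier → Carrier → Set (c ⊔ ℓ ⊔ i) where
    ≤B-refl : ∀ {u v} → u ≈ v → u ≤B v
    ≤B-step : ∀ {u x v} → Arrow u x → x ≤B v → u ≤B v

  _⋖_ : Carrier → Carrier → Set (c ⊔ ℓ ⊔ i)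
  a ⋖ b = a ≤B b × ¬ (a ≈ b) × ∃ λ n → Len a n × Len b (suc n)

  ChainProperty : ∀ {p} → (Carrier → Set p) → Set (c ⊔ ℓ ⊔ i ⊔ p)
  ChainProperty P = ∀ v w → P v → P w → v ≤B w →
    ∃ λ (n : ℕ) → ∃ λ (x : ℕ → Carrier) →
      x 0 ≈ v × x n ≈ w ×
      (∀ k → k < n → x k ⋖ x (suc k)) ×
      (∀ k → k ≤ n → P (x k))

  IntervalL : Carrier → Carrier → Set (ℓ ⊔ i)
  IntervalL u w = w ≤L u

  IntervalR : Carrier → Carrier → Set (ℓ ⊔ i)
  IntervalR u w = w ≤R u

{-# OPTIONS --safe #-}
module Submission where

-- A word s₁…sₙ has the left inversions s₁…sₖ₋₁ sₖ sₖ₋₁…s₁, and two words for the same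
-- element have the same inversions modulo 2.  This is read off from a homomorphism of W
-- to the semidirect product of W with the free 𝔽₂-vector space on W.  Equality mod 2 is
-- kept as an explicit matching of list entries, because equality in W is not known to be
-- decidable here; chasing the matchings yields the strong exchange condition and subwords.
--
-- For right intervals let v ≤ w be prefixes of u, with v a subword of the reduced word
-- s w′ of w.  If that subword uses s, then s can be cancelled from v, w and u.  Otherwise
-- look at s in the reduced word v q of u.  If s is an inversion of v, then v can be
-- rewritten to start with s.  If not, exchange deletes a letter of q, so u = s v q′ and
-- s v is a prefix of u covering v; continue from s v.  Left intervals follow by inversion.

open import Defs
open import Level using (Level; _⊔_)
open import Algebra.Bundles using (Group)
open import Algebra.Morphism.Structures using (module GroupMorphisms)
import Algebra.Properties.Group as GroupProperties
import Algebra.Solver.CommutativeMonoid as CommutativeMonoidSolver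
open import Data.Empty using (⊥-elim)
open import Data.Empty.Polymorphic using (⊥)
open import Data.Fin using (Fin; zero; suc)
open import Data.List using (List; []; _∷_; [_]; _++_; length; map; lookup; removeAt; reverse)
import Data.List.Membership.Setoid as Membership
import Data.List.Membership.Setoid.Properties as Membershipₚ
import Data.List.Properties as List
import Data.List.Relation.Binary.Equality.Setoid as ListEquality
import Data.List.Relation.Binary.Permutation.Setoid as Permutation
import Data.List.Relation.Binary.Permutation.Setoid.Properties as Permutationₚ
import Data.List.Relation.Binary.Pointwise as Pointwise
open Pointwise using ([]; _∷_)
open import Data.List.Relation.Binary.Sublist.Propositional using (_⊆_; []; _∷ʳ_; _∷_; ⊆-refl; ⊆-trans)
open import Data.List.Relation.Unary.Any using (here; there; index; _─_)
import Data.List.Relation.Unary.Any.Properties as Any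
open import Data.Nat using (ℕ; zero; suc; _+_; _<_; _≤_; s≤s)
import Data.Nat.Properties as ℕ
open import Data.Product using (Σ; ∃; _×_; _,_; proj₁; proj₂)
open import Data.Sum using (_⊎_; inj₁; inj₂; [_,_]′)
open import Data.Unit.Polymorphic using (⊤)
open import Relation.Binary.Bundles using (Setoid)
open import Relation.Binary.PropositionalEquality as ≡ using (_≡_; _≢_)
import Relation.Binary.Reasoning.Setoid as SetoidReasoning
open import Relation.Nullary using (Dec; yes; no)

-- Lists whose entries cancel in pairs.

module Pairing {a ℓ : Level} (S : Setoid a ℓ) where
  open Setoid S renaming (Carrier to A; refl to ≈-refl; sym to ≈-sym; trans to ≈-trans)
  open Permutation S public
  open Permutationₚ S public
  open Membership S public using (_∈_)
  open CommutativeMonoidSolver ++-commutativeMonoid public using (solve; _⊜_; _⊕_)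
  open PermutationReasoning

  -- Says that the sum of the entries vanishes over 𝔽₂. Counting parities would require deciding
  -- equality in `A`, so a witness lists the cancelling pairs instead.
  data Paired : List A → Set (a ⊔ ℓ) where
    none : Paired []
    pair : ∀ {l k} x → l ↭ x ∷ x ∷ k → Paired k → Paired l

  ↭[]⇒≡[] : ∀ {l} → l ↭ [] → l ≡ []
  ↭[]⇒≡[] {[]} p = ≡.refl
  ↭[]⇒≡[] {_ ∷ _} p with () ← xs↭ys⇒|xs|≡|ys| p

  Paired-resp-↭ : ∀ {l k} → l ↭ k → Paired l → Paired k
  Paired-resp-↭ p none with ≡.refl ← ↭[]⇒≡[] (↭-sym p) = none
  Paired-resp-↭ p (pair x q r) = pair x (↭-trans (↭-sym p) q) r

  ↭-removeAt : ∀ l (i : Fin (length l)) → l ↭ lookup l i ∷ removeAt l i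
  ↭-removeAt (x ∷ l) zero = ↭-refl
  ↭-removeAt (x ∷ l) (suc i) =
    ↭-trans (↭-prep x (↭-removeAt l i)) (↭-swap x _ ↭-refl)

  ∈⇒↭ : ∀ {x l} → x ∈ l → ∃ λ k → l ↭ x ∷ k
  ∈⇒↭ {l = l} m = (l ─ m) ,
    ↭-trans (↭-removeAt l (index m)) (prep (≈-sym (Any.lookup-index m)) ↭-refl)

  -- If `x` equals the entry `y` of the first recorded pair, the other copy of `y` is its partner.
  -- Otherwise `x` occurs in `k`, where induction supplies a partner, and the pair of `y` is put
  -- back.
  partner : ∀ {l x m} → Paired l → l ↭ x ∷ m → ∃ λ k → m ↭ x ∷ k × Paired k
  partner none p with () ← xs↭ys⇒|xs|≡|ys| p
  partner {x = x} (pair {k = k} y q r) p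
    with ∈-resp-↭ (↭-trans (↭-sym p) q) (here ≈-refl)
  ... | here x≈y = k , drop-∷ (↭-trans (↭-sym p) (↭-trans q
          (prep (≈-sym x≈y) (prep (≈-sym x≈y) ↭-refl)))) , r
  ... | there (here x≈y) = k , drop-∷ (↭-trans (↭-sym p) (↭-trans q
          (prep (≈-sym x≈y) (prep (≈-sym x≈y) ↭-refl)))) , r
  ... | there (there x∈k) with ∈⇒↭ x∈k
  ... | k₁ , k↭x∷k₁ with partner r k↭x∷k₁
  ... | k₂ , k₁↭x∷k₂ , s = y ∷ y ∷ k₂ , drop-∷ eq , pair y ↭-refl s
    where
    eq = begin
      x ∷ _                    ↭⟨ p ⟨
      _                        ↭⟨ q ⟩
      y ∷ y ∷ k                ↭⟨ ↭-prep y (↭-prep y k↭x∷k₁) ⟩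
      y ∷ y ∷ x ∷ k₁           ↭⟨ ↭-prep y (↭-prep y (↭-prep x k₁↭x∷k₂)) ⟩
      y ∷ y ∷ x ∷ x ∷ k₂       ↭⟨ solve 3 (λ x y k → y ⊕ y ⊕ x ⊕ x ⊕ k ⊜ x ⊕ x ⊕ y ⊕ y ⊕ k) ↭-refl [ x ] [ y ] k₂ ⟩
      x ∷ x ∷ y ∷ y ∷ k₂       ∎

  Paired-unpair : ∀ {x l} → Paired (x ∷ x ∷ l) → Paired l
  Paired-unpair p with partner p ↭-refl
  ... | k , q , r = Paired-resp-↭ (↭-sym (drop-∷ q)) r

  Paired-++ : ∀ {l k} → Paired l → Paired k → Paired (l ++ k)
  Paired-++ none q = q
  Paired-++ {k = k} (pair x p r) q = pair x (++⁺ʳ k p) (Paired-++ r q)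

  Paired-double : ∀ l → Paired (l ++ l)
  Paired-double [] = none
  Paired-double (x ∷ l) = pair x (↭-prep x (↭-shift l l)) (Paired-double l)

  -- Lets the middle list drop out in the transitivity of `_~_`.
  Paired-cancel : ∀ l {k} → Paired (l ++ l ++ k) → Paired k
  Paired-cancel [] p = p
  Paired-cancel (x ∷ l) {k} p =
    Paired-cancel l (Paired-unpair (Paired-resp-↭ (↭-prep x (↭-shift l (l ++ k))) p))

  Paired-map : ∀ {f} → (∀ {x y} → x ≈ y → f x ≈ f y) → ∀ {l} → Paired l → Paired (map f l)
  Paired-map cong none = none
  Paired-map cong (pair x p r) = pair _ (map⁺ S cong p) (Paired-map cong r)

  ↭⇒Paired : ∀ {l k} → l ↭ k → Paired (l ++ k)
  ↭⇒Paired {l} p = Paired-resp-↭ (++⁺ˡ l p) (Paired-double l)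

  -- Paired quantifies over A and lives in a ⊔ ℓ.  Matching by positions brings the
  -- relation down to ℓ, as the universal property of a Coxeter system demands.
  Matched : ℕ → List A → Set ℓ
  Matched zero    []      = ⊤
  Matched zero    (_ ∷ _) = ⊥
  Matched (suc n) []      = ⊥
  Matched (suc n) (x ∷ l) =
    Σ (Fin (length l)) λ i → x ≈ lookup l i × Matched n (removeAt l i)

  Matched⇒Paired : ∀ n {l} → Matched n l → Paired l
  Matched⇒Paired zero    {[]}    _ = none
  Matched⇒Paired (suc n) {x ∷ l} (i , x≈ , r) =
    pair x (↭-prep x (↭-trans (↭-removeAt l i) (prep (≈-sym x≈) ↭-refl)))
      (Matched⇒Paired n r)

  Paired⇒Matched : ∀ n {l} → length l ≤ n → Paired l → ∃ λ m → Matched m l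
  Paired⇒Matched _ {[]} _ _ = zero , _
  -- Removing the partner by position leaves a list that is no syntactic part of `l`, so the
  -- recursion runs on the bound `n`.
  Paired⇒Matched (suc n) {x ∷ l} (s≤s |l|≤n) p with partner p ↭-refl
  ... | k , l↭x∷k , r = suc (proj₁ rec) , index x∈l , Any.lookup-index x∈l , proj₂ rec
    where
    x∈l = ∈-resp-↭ (↭-sym l↭x∷k) (here ≈-refl)
    rest : Paired (l ─ x∈l)
    rest = Paired-resp-↭ (drop-∷ (begin
      x ∷ k           ↭⟨ l↭x∷k ⟨
      l               ↭⟨ ↭-removeAt l (index x∈l) ⟩
      lookup l (index x∈l) ∷ (l ─ x∈l) ↭⟨ prep (≈-sym (Any.lookup-index x∈l)) ↭-refl ⟩
      x ∷ (l ─ x∈l)   ∎)) r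
    rec = Paired⇒Matched n (ℕ.≤-trans (ℕ.n≤1+n _) (ℕ.≤-trans
            (ℕ.≤-reflexive (≡.sym (List.length-removeAt′ l (index x∈l)))) |l|≤n)) rest

  -- An entry of `k` absorbs at most one entry of `l`, so the longer `l` must have two entries
  -- matched to each other. The induction removes the head `y` of `k` with its partner; whether that
  -- lies in `l` or in `k`, `l` stays longer.
  pigeonhole : ∀ n l k → length k ≤ n → length k < length l → Paired (l ++ k) →
               ∃ λ x → ∃ λ m → l ↭ x ∷ x ∷ m
  pigeonhole _ (x ∷ l) [] _ _ p with partner p (↭-prep x (++-identityʳ l))
  ... | m , l↭x∷m , _ = x , m , ↭-prep x l↭x∷m
  pigeonhole (suc n) l (y ∷ k) (s≤s k≤n) k<l p with partner p (↭-shift l k)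
  ... | m , q , r with Membershipₚ.∈-++⁻ S l (∈-resp-↭ (↭-sym q) (here ≈-refl))
  ... | inj₁ y∈l = x , y ∷ m′ , (begin
            l               ↭⟨ e ⟩
            y ∷ l′          ↭⟨ ↭-prep y f ⟩
            y ∷ x ∷ x ∷ m′  ↭⟨ ↭-shift (x ∷ x ∷ []) m′ ⟨
            x ∷ x ∷ y ∷ m′  ∎)
    where
    l′ = proj₁ (∈⇒↭ y∈l)
    e : l ↭ y ∷ l′
    e = proj₂ (∈⇒↭ y∈l)
    rest : Paired (l′ ++ k)
    rest = Paired-resp-↭ (drop-∷ (↭-trans (↭-sym q) (++⁺ʳ k e))) r
    |l|≡ = xs↭ys⇒|xs|≡|ys| e
    rec = pigeonhole n l′ k k≤n (ℕ.≤-pred (≡.subst (suc (length k) <_) |l|≡ k<l)) rest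
    x = proj₁ rec
    m′ = proj₁ (proj₂ rec)
    f = proj₂ (proj₂ rec)
  ... | inj₂ y∈k = pigeonhole n l k′ (ℕ.≤-trans |k′|≤ k≤n)
                     (ℕ.≤-<-trans |k′|≤ (ℕ.<-trans (ℕ.n<1+n _) k<l)) rest
    where
    k′ = proj₁ (∈⇒↭ y∈k)
    e : k ↭ y ∷ k′
    e = proj₂ (∈⇒↭ y∈k)
    |k′|≤ : length k′ ≤ length k
    |k′|≤ = ℕ.≤-trans (ℕ.n≤1+n _) (ℕ.≤-reflexive (≡.sym (xs↭ys⇒|xs|≡|ys| e)))
    rest : Paired (l ++ k′)
    rest = Paired-resp-↭ (drop-∷ (↭-trans (↭-sym q) (↭-trans (++⁺ˡ l e) (↭-shift l k′)))) r

-- Conjugation in a group.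

module Conjugation {c ℓ : Level} (G : Group c ℓ) where
  open Group G
  open GroupProperties G using (⁻¹-anti-homo-∙; ε⁻¹≈ε)
  open SetoidReasoning setoid

  conj : Carrier → Carrier → Carrier
  conj g x = g ∙ x ∙ g ⁻¹

  conj-cong₂ : ∀ {g h x y} → g ≈ h → x ≈ y → conj g x ≈ conj h y
  conj-cong₂ p q = ∙-cong (∙-cong p q) (⁻¹-cong p)

  conj-cong : ∀ g {x y} → x ≈ y → conj g x ≈ conj g y
  conj-cong g = conj-cong₂ refl

  conj-∙ : ∀ g h x → conj (g ∙ h) x ≈ conj g (conj h x)
  conj-∙ g h x = begin
    g ∙ h ∙ x ∙ (g ∙ h) ⁻¹        ≈⟨ ∙-congˡ (⁻¹-anti-homo-∙ g h) ⟩
    g ∙ h ∙ x ∙ (h ⁻¹ ∙ g ⁻¹)     ≈⟨ assoc _ _ _ ⟨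
    g ∙ h ∙ x ∙ h ⁻¹ ∙ g ⁻¹       ≈⟨ ∙-congʳ (∙-congʳ (assoc _ _ _)) ⟩
    g ∙ (h ∙ x) ∙ h ⁻¹ ∙ g ⁻¹     ≈⟨ ∙-congʳ (assoc _ _ _) ⟩
    conj g (conj h x)             ∎

  conj-ε : ∀ x → conj ε x ≈ x
  conj-ε x = begin
    ε ∙ x ∙ ε ⁻¹  ≈⟨ ∙-cong (identityˡ x) ε⁻¹≈ε ⟩
    x ∙ ε         ≈⟨ identityʳ x ⟩
    x             ∎

  conj-inverseˡ : ∀ g x → conj (g ⁻¹) (conj g x) ≈ x
  conj-inverseˡ g x = trans (sym (conj-∙ _ _ x)) (trans (conj-cong₂ (inverseˡ g) refl) (conj-ε x))

  conj-commute : ∀ g x → conj g x ∙ g ≈ g ∙ x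
  conj-commute g x = begin
    g ∙ x ∙ g ⁻¹ ∙ g    ≈⟨ assoc _ _ _ ⟩
    g ∙ x ∙ (g ⁻¹ ∙ g)  ≈⟨ ∙-congˡ (inverseˡ g) ⟩
    g ∙ x ∙ ε           ≈⟨ identityʳ _ ⟩
    g ∙ x               ∎

  conj-commute-∙ : ∀ g x y → conj g x ∙ (g ∙ y) ≈ g ∙ (x ∙ y)
  conj-commute-∙ g x y = begin
    conj g x ∙ (g ∙ y)  ≈⟨ assoc _ _ _ ⟨
    conj g x ∙ g ∙ y    ≈⟨ ∙-congʳ (conj-commute g x) ⟩
    g ∙ x ∙ y           ≈⟨ assoc _ _ _ ⟩
    g ∙ (x ∙ y)         ∎

  conj-self : ∀ g → conj g g ≈ g
  conj-self g = begin
    g ∙ g ∙ g ⁻¹    ≈⟨ assoc _ _ _ ⟩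
    g ∙ (g ∙ g ⁻¹)  ≈⟨ ∙-congˡ (inverseʳ g) ⟩
    g ∙ ε           ≈⟨ identityʳ g ⟩
    g               ∎

  conj-square : ∀ g {x} → x ∙ x ≈ ε → conj g x ∙ conj g x ≈ ε
  conj-square g {x} p = begin
    conj g x ∙ (g ∙ x ∙ g ⁻¹)    ≈⟨ ∙-congˡ (assoc _ _ _) ⟩
    conj g x ∙ (g ∙ (x ∙ g ⁻¹))  ≈⟨ conj-commute-∙ g x _ ⟩
    g ∙ (x ∙ (x ∙ g ⁻¹))         ≈⟨ ∙-congˡ (assoc _ _ _) ⟨
    g ∙ (x ∙ x ∙ g ⁻¹)           ≈⟨ ∙-congˡ (∙-congʳ p) ⟩
    g ∙ (ε ∙ g ⁻¹)               ≈⟨ ∙-congˡ (identityˡ _) ⟩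
    g ∙ g ⁻¹                     ≈⟨ inverseʳ g ⟩
    ε                            ∎

-- The semidirect product of G with the free 𝔽₂-vector space on the set G, on which G
-- acts by conjugation: a list represents the sum of its entries.
module SignedGroup {c ℓ : Level} (G : Group c ℓ) where
  open Group G hiding (isEquivalence)
  open Conjugation G public
  open Pairing setoid public hiding (refl; trans; swap)
  open ListEquality setoid public using (_≋_; ≋-refl; ≋-sym; ≋-trans)

  infix 4 _~_
  record _~_ (l k : List Carrier) : Set ℓ where
    constructor matching
    field
      {size} : ℕ
      matched : Matched size (l ++ k)

  ~⇒Paired : ∀ {l k} → l ~ k → Paired (l ++ k)
  ~⇒Paired (matching p) = Matched⇒Paired _ p

  Paired⇒~ : ∀ {l k} → Paired (l ++ k) → l ~ k
  Paired⇒~ p = matching (proj₂ (Paired⇒Matched _ ℕ.≤-refl p))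

  ↭⇒~ : ∀ {l k} → l ↭ k → l ~ k
  ↭⇒~ p = Paired⇒~ (↭⇒Paired p)

  ~-sym : ∀ {l k} → l ~ k → k ~ l
  ~-sym {l} {k} p = Paired⇒~ (Paired-resp-↭ (++-comm l k) (~⇒Paired p))

  ~-trans : ∀ {l k m} → l ~ k → k ~ m → l ~ m
  ~-trans {l} {k} {m} p q = Paired⇒~ (Paired-cancel k (Paired-resp-↭
    (solve 3 (λ l k m → (l ⊕ k) ⊕ (k ⊕ m) ⊜ k ⊕ k ⊕ l ⊕ m) ↭-refl l k m)
    (Paired-++ (~⇒Paired p) (~⇒Paired q))))

  ~-++ : ∀ {l l′ k k′} → l ~ l′ → k ~ k′ → l ++ k ~ l′ ++ k′
  ~-++ {l} {l′} {k} {k′} p q = Paired⇒~ (Paired-resp-↭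
    (solve 4 (λ l l′ k k′ → (l ⊕ l′) ⊕ (k ⊕ k′) ⊜ (l ⊕ k) ⊕ (l′ ⊕ k′)) ↭-refl l l′ k k′)
    (Paired-++ (~⇒Paired p) (~⇒Paired q)))

  act : Carrier → List Carrier → List Carrier
  act g = map (conj g)

  act-↭ : ∀ g {l k} → l ↭ k → act g l ↭ act g k
  act-↭ g = map⁺ setoid (conj-cong g)

  ≋-map : ∀ {f h : Carrier → Carrier} → (∀ x → f x ≈ h x) → ∀ l → map f l ≋ map h l
  ≋-map p [] = []
  ≋-map p (x ∷ l) = p x ∷ ≋-map p l

  act-cong : ∀ {g h} → g ≈ h → ∀ l → act g l ≋ act h l
  act-cong p = ≋-map (λ _ → conj-cong₂ p refl)

  act-∙ : ∀ g h l → act (g ∙ h) l ≋ act g (act h l)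
  act-∙ g h l rewrite ≡.sym (List.map-∘ {g = conj g} {f = conj h} l) = ≋-map (conj-∙ g h) l

  act-ε : ∀ l → act ε l ≋ l
  act-ε [] = []
  act-ε (x ∷ l) = conj-ε x ∷ act-ε l

  act-~ : ∀ {g h l k} → g ≈ h → l ~ k → act g l ~ act h k
  act-~ {g} {h} {l} {k} p q = ~-trans (↭⇒~ (↭-reflexive-≋ (act-cong p l)))
    (Paired⇒~ (≡.subst Paired (List.map-++ (conj h) l k) (Paired-map (conj-cong h) (~⇒Paired q))))

  signedGroup : Group c ℓ
  signedGroup = record
    { Carrier = Carrier × List Carrier
    ; _≈_ = λ (g , l) (h , k) → g ≈ h × l ~ k
    ; _∙_ = λ (g , l) (h , k) → g ∙ h , l ++ act g k
    ; ε = ε , []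
    -- Over 𝔽₂ a list is its own negative, so inversion only conjugates it.
    ; _⁻¹ = λ (g , l) → g ⁻¹ , act (g ⁻¹) l
    ; isGroup = record
      { isMonoid = record
        { isSemigroup = record
          { isMagma = record
            { isEquivalence = record
              { refl = refl , ↭⇒~ ↭-refl
              ; sym = λ (p , q) → sym p , ~-sym q
              ; trans = λ (p , q) (p′ , q′) → trans p p′ , ~-trans q q′
              }
            ; ∙-cong = λ (p , q) (p′ , q′) → ∙-cong p p′ , ~-++ q (act-~ p q′)
            }
          ; assoc = λ (g , l) (h , k) (j , m) → assoc g h j , ↭⇒~ (++-act-assoc g h l k m)
          }
        ; identity = (λ (g , l) → identityˡ g , ↭⇒~ (↭-reflexive-≋ (act-ε l)))
                   , (λ (g , l) → identityʳ g , ↭⇒~ (++-identityʳ l))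
        }
      ; inverse = (λ (g , l) → inverseˡ g ,
                     Paired⇒~ (Paired-resp-↭ (↭-sym (++-identityʳ _)) (Paired-double (act (g ⁻¹) l))))
                , (λ (g , l) → inverseʳ g , Paired⇒~ (Paired-resp-↭ (↭-sym (++-identityʳ _))
                     (↭⇒Paired (↭-reflexive-≋ (≋-sym (act-inverse g l))))))
      ; ⁻¹-cong = λ (p , q) → ⁻¹-cong p , act-~ (⁻¹-cong p) q
      }
    }
    where
    act-inverse : ∀ g l → act g (act (g ⁻¹) l) ≋ l
    act-inverse g l =
      ≋-trans (≋-sym (act-∙ g (g ⁻¹) l)) (≋-trans (act-cong (inverseʳ g) l) (act-ε l))

    ++-act-assoc : ∀ g h l k m →
      (l ++ act g k) ++ act (g ∙ h) m ↭ l ++ act g (k ++ act h m)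
    ++-act-assoc g h l k m rewrite List.map-++ (conj g) k (act h m) =
      ↭-trans (++-assoc l (act g k) (act (g ∙ h) m))
        (++⁺ˡ l (++⁺ˡ (act g k) (↭-reflexive-≋ (act-∙ g h m))))

-- Inversions of words and deletion of letters.

module Inversions {c ℓ i : Level} (CS : CoxeterSystem c ℓ i) where
  open CoxeterSystem CS
  open Group W
  open GroupProperties W using (inverseʳ-unique; ⁻¹-anti-homo-∙; ∙-cancelˡ)
  open SignedGroup W
  open SetoidReasoning setoid
  private module ↭R = PermutationReasoning

  gen-square : ∀ a → gen a ∙ gen a ≈ ε
  gen-square a = trans (sym (identityʳ _))
    (≡.subst (λ n → pow W (gen a ∙ gen a) n ≈ ε) (m-diag a)
      (rel a a (λ m≡0 → ℕ.1+n≢0 (≡.trans (≡.sym (m-diag a)) m≡0))))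

  gen⁻¹ : ∀ a → gen a ⁻¹ ≈ gen a
  gen⁻¹ a = sym (inverseʳ-unique _ _ (gen-square a))

  gen-cancel : ∀ a x → gen a ∙ (gen a ∙ x) ≈ x
  gen-cancel a x = trans (sym (assoc _ _ _)) (trans (∙-congʳ (gen-square a)) (identityˡ x))

  -- In the dihedral group of a rotation r, the reflections x, r x, r² x, …
  run : Carrier → Carrier → ℕ → List Carrier
  run r x zero    = []
  run r x (suc n) = x ∷ run r (r ∙ x) n

  run-cong : ∀ r {x y} n → x ≈ y → run r x n ≋ run r y n
  run-cong r zero    p = []
  run-cong r (suc n) p = p ∷ run-cong r n (∙-congˡ p)

  pow-comm : ∀ r n → pow W r n ∙ r ≈ r ∙ pow W r n
  pow-comm r zero    = trans (identityˡ r) (sym (identityʳ r))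
  pow-comm r (suc n) = trans (assoc _ _ _) (∙-congˡ (pow-comm r n))

  run-+ : ∀ r x m n → run r x (m + n) ≋ run r x m ++ run r (pow W r m ∙ x) n
  run-+ r x zero    n = run-cong r n (sym (identityˡ x))
  run-+ r x (suc m) n = refl ∷ ≋-trans (run-+ r (r ∙ x) m n)
    (Pointwise.++⁺ ≋-refl (run-cong r n (trans (sym (assoc _ _ _)) (∙-congʳ (pow-comm r m)))))

  -- Conjugation by `r` sends `x` to r² x and commutes with left multiplication by `r`, so the whole
  -- run moves on by two places.
  act-run : ∀ r {x} n → conj r x ≈ r ∙ (r ∙ x) → act r (run r x n) ≋ run r (r ∙ (r ∙ x)) n
  act-run r zero    p = []
  act-run r {x} (suc n) p = p ∷ act-run r n (begin
    r ∙ (r ∙ x) ∙ r ⁻¹  ≈⟨ assoc _ _ _ ⟩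
    r ∙ (r ∙ x ∙ r ⁻¹)  ≈⟨ ∙-congˡ p ⟩
    r ∙ (r ∙ (r ∙ x))   ∎)

  signed : I → Group.Carrier signedGroup
  signed a = gen a , [ gen a ]

  -- A new factor r = `gen a ∙ gen b` in front contributes the reflections `gen a` and r `gen a`;
  -- its conjugation shifts the earlier run by two places, just behind them.
  signed-pow : ∀ a b n → let (g , l) = pow signedGroup (Group._∙_ signedGroup (signed a) (signed b)) n in
    g ≈ pow W (gen a ∙ gen b) n × l ≋ run (gen a ∙ gen b) (gen a) (n + n)
  signed-pow a b zero = refl , []
  signed-pow a b (suc n) rewrite ℕ.+-suc n n = ∙-congˡ (proj₁ rec) ,
    refl ∷ conj-gen ∷ ≋-trans (act-≋ (proj₂ rec)) (act-run r (n + n) rotate)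
    where
    r = gen a ∙ gen b
    rec = signed-pow a b n
    act-≋ : ∀ {l k} → l ≋ k → act r l ≋ act r k
    act-≋ [] = []
    act-≋ (p ∷ q) = conj-cong r p ∷ act-≋ q
    conj-gen : conj (gen a) (gen b) ≈ r ∙ gen a
    conj-gen = ∙-congˡ (gen⁻¹ a)
    rotate : conj r (gen a) ≈ r ∙ (r ∙ gen a)
    rotate = begin
      r ∙ gen a ∙ r ⁻¹                    ≈⟨ assoc _ _ _ ⟩
      r ∙ (gen a ∙ r ⁻¹)                  ≈⟨ ∙-congˡ (∙-congˡ (⁻¹-anti-homo-∙ _ _)) ⟩
      r ∙ (gen a ∙ (gen b ⁻¹ ∙ gen a ⁻¹)) ≈⟨ ∙-congˡ (∙-congˡ (∙-cong (gen⁻¹ b) (gen⁻¹ a))) ⟩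
      r ∙ (gen a ∙ (gen b ∙ gen a))       ≈⟨ ∙-congˡ (assoc _ _ _) ⟨
      r ∙ (r ∙ gen a)                     ∎

  -- Running twice around the dihedral group meets every reflection twice.
  signed-rel : ∀ a b → m a b ≢ 0 →
    Group._≈_ signedGroup
      (pow signedGroup (Group._∙_ signedGroup (signed a) (signed b)) (m a b)) (Group.ε signedGroup)
  signed-rel a b m≢0 with signed-pow a b (m a b)
  ... | g≈ , l≋ = trans g≈ (rel a b m≢0) ,
    Paired⇒~ (Paired-resp-↭ (↭-sym (↭-trans (++-identityʳ _) (↭-reflexive-≋
      (≋-trans l≋ (≋-trans (run-+ r (gen a) (m a b) (m a b))
        (Pointwise.++⁺ ≋-refl (run-cong r (m a b) (trans (∙-congʳ (rel a b m≢0)) (identityˡ _)))))))))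
      (Paired-double (run r (gen a) (m a b))))
    where r = gen a ∙ gen b

  -- Left inversions, repeated if ws is not reduced.
  inversions : List I → List Carrier
  inversions []       = []
  inversions (a ∷ ws) = gen a ∷ act (gen a) (inversions ws)

  -- The universal property sends prod ws to (prod ws , inversions ws) in signedGroup.
  inversions-unique : ∀ ws vs → prod ws ≈ prod vs → Paired (inversions ws ++ inversions vs)
  inversions-unique ws vs p with universal signedGroup signed signed-rel
  ... | h , h-homo , h-gen = ~⇒Paired (proj₂
      (Group.trans signedGroup (Group.sym signedGroup (h-prod ws))
        (Group.trans signedGroup (⟦⟧-cong p) (h-prod vs))))
    where
    open GroupMorphisms.IsGroupHomomorphism h-homo
    h-prod : ∀ ws → Group._≈_ signedGroup (h (prod ws)) (prod ws , inversions ws)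
    h-prod [] = ε-homo
    h-prod (a ∷ ws) = Group.trans signedGroup (homo (gen a) (prod ws))
      (Group.∙-cong signedGroup {x = h (gen a)} {y = signed a} (h-gen a) (h-prod ws))

  prod-++ : ∀ us vs → prod (us ++ vs) ≈ prod us ∙ prod vs
  prod-++ []       vs = sym (identityˡ _)
  prod-++ (a ∷ us) vs = trans (∙-congˡ (prod-++ us vs)) (sym (assoc _ _ _))

  inversions-++ : ∀ us vs → inversions (us ++ vs) ≋ inversions us ++ act (prod us) (inversions vs)
  inversions-++ []       vs = ≋-sym (act-ε _)
  inversions-++ (a ∷ us) vs =
    refl ∷ ≋-trans
      (Pointwise.map⁺ _ _ (Pointwise.map (conj-cong (gen a)) (inversions-++ us vs)))
      (≡.subst (_≋ act (gen a) (inversions us) ++ act (gen a ∙ prod us) (inversions vs))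
        (≡.sym (List.map-++ (conj (gen a)) (inversions us) (act (prod us) (inversions vs))))
        (Pointwise.++⁺ ≋-refl (≋-sym (act-∙ (gen a) (prod us) (inversions vs)))))

  length-inversions : ∀ ws → length (inversions ws) ≡ length ws
  length-inversions []       = ≡.refl
  length-inversions (a ∷ ws) =
    ≡.cong suc (≡.trans (List.length-map _ (inversions ws)) (length-inversions ws))

  -- Multiplying s₁...sₙ from the left by s₁...sₖ...s₁ cancels the first k letters and puts back the
  -- first k - 1, so exactly the k-th letter disappears.
  deletion : ∀ {t} ws → t ∈ inversions ws →
    ∃ λ vs → vs ⊆ ws × length ws ≡ suc (length vs) × prod vs ≈ t ∙ prod ws
  deletion (a ∷ ws) (here t≈a) = ws , a ∷ʳ ⊆-refl , ≡.refl ,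
    sym (trans (∙-congʳ t≈a) (gen-cancel a _))
  deletion {t} (a ∷ ws) (there t∈) with Membershipₚ.∈-map⁻ setoid setoid t∈
  ... | s , s∈ , t≈ with deletion ws s∈
  ... | vs , vs⊆ws , eq , p = a ∷ vs , ≡.refl ∷ vs⊆ws , ≡.cong suc eq , (begin
    gen a ∙ prod vs                    ≈⟨ ∙-congˡ p ⟩
    gen a ∙ (s ∙ prod ws)              ≈⟨ conj-commute-∙ _ _ _ ⟨
    conj (gen a) s ∙ (gen a ∙ prod ws) ≈⟨ ∙-congʳ t≈ ⟨
    t ∙ (gen a ∙ prod ws)              ∎)

  ∈-act⁻ : ∀ {g x l} → conj g x ∈ act g l → x ∈ l
  ∈-act⁻ {g} {x} {l} p with Membershipₚ.∈-map⁻ setoid setoid p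
  ... | y , y∈l , gx≈gy = Membershipₚ.∈-resp-≈ setoid
    (trans (sym (conj-inverseˡ g y)) (trans (conj-cong (g ⁻¹) (sym gx≈gy)) (conj-inverseˡ g x))) y∈l

  act⁻¹-↭ : ∀ g {l k} → act g l ↭ k → l ↭ act (g ⁻¹) k
  act⁻¹-↭ g {l} p = ↭-trans (↭-reflexive-≋ (≋-sym (≋-trans (≋-sym (act-∙ (g ⁻¹) g l))
    (≋-trans (act-cong (inverseˡ g) l) (act-ε l))))) (act-↭ (g ⁻¹) p)

  -- If the first letter accounts for one copy of `x`, deleting the letter of the other copy from
  -- `ws` already produces `prod (a ∷ ws)`, with `a` gone as well. Otherwise both copies come from
  -- `ws`, and conjugation by `gen a` carries the repetition back there.
  double-deletion : ∀ {x k} ws → inversions ws ↭ x ∷ x ∷ k →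
    ∃ λ vs → vs ⊆ ws × length ws ≡ suc (suc (length vs)) × prod vs ≈ prod ws
  double-deletion [] p with () ← xs↭ys⇒|xs|≡|ys| p
  double-deletion {x} {k} (a ∷ ws) p = [ head-paired , tail-paired ]′ cases
    where
    cases : gen a ≈ x ⊎ gen a ∈ k
    cases with ∈-resp-↭ p (here refl)
    ... | here q          = inj₁ q
    ... | there (here q)  = inj₁ q
    ... | there (there q) = inj₂ q
    Shortened = ∃ λ vs → vs ⊆ a ∷ ws × length (a ∷ ws) ≡ suc (suc (length vs)) × prod vs ≈ prod (a ∷ ws)
    head-paired : gen a ≈ x → Shortened
    head-paired a≈x with deletion ws (∈-act⁻ (∈-resp-↭
      (↭-sym (drop-∷ (↭-trans p (prep (sym a≈x) ↭-refl)))) (here (trans (conj-self (gen a)) a≈x))))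
    ... | vs , vs⊆ws , eq , q = vs , a ∷ʳ vs⊆ws , ≡.cong suc eq , q
    tail-paired : gen a ∈ k → Shortened
    tail-paired a∈k with ∈⇒↭ a∈k
    ... | k′ , k↭ with double-deletion ws (act⁻¹-↭ (gen a) (drop-∷
            (↭-trans p (↭-trans (++⁺ˡ (x ∷ x ∷ []) k↭) (↭-shift (x ∷ x ∷ []) k′)))))
    ... | vs , vs⊆ws , eq , q = a ∷ vs , ≡.refl ∷ vs⊆ws , ≡.cong suc eq , ∙-congˡ q

  -- Palindromic words for reflections.

  reflectionWord : List I → I → List I
  reflectionWord []       a = [ a ]
  reflectionWord (b ∷ us) a = b ∷ reflectionWord us a ++ [ b ]

  prod-reflectionWord : ∀ us a → prod (reflectionWord us a) ≈ conj (prod us) (gen a)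
  prod-reflectionWord [] a = trans (identityʳ _) (sym (conj-ε _))
  prod-reflectionWord (b ∷ us) a = begin
    gen b ∙ prod (reflectionWord us a ++ [ b ])        ≈⟨ ∙-congˡ (prod-++ (reflectionWord us a) [ b ]) ⟩
    gen b ∙ (prod (reflectionWord us a) ∙ (gen b ∙ ε)) ≈⟨ ∙-congˡ (∙-cong (prod-reflectionWord us a) (identityʳ _)) ⟩
    gen b ∙ (conj (prod us) (gen a) ∙ gen b)           ≈⟨ ∙-congˡ (∙-congˡ (gen⁻¹ b)) ⟨
    gen b ∙ (conj (prod us) (gen a) ∙ gen b ⁻¹)        ≈⟨ assoc _ _ _ ⟨
    conj (gen b) (conj (prod us) (gen a))              ≈⟨ conj-∙ _ _ _ ⟨
    conj (prod (b ∷ us)) (gen a)                       ∎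

  -- Letters of the palindrome in mirror positions have inversions conjugate under `t`; the middle
  -- letter has inversion `t` itself. The list `B` consists of the inversions of `us`.
  inversions-reflectionWord : ∀ us a → let t = conj (prod us) (gen a) in
    ∃ λ B → inversions (reflectionWord us a) ↭ t ∷ B ++ act t B
  inversions-reflectionWord [] a = [] , prep (sym (conj-ε _)) ↭-refl
  inversions-reflectionWord (b ∷ us) a with inversions-reflectionWord us a
  ... | B , p = gen b ∷ act (gen b) B , (↭R.begin
    gen b ∷ act (gen b) (inversions (z ++ [ b ]))
      ↭R.↭⟨ ↭-prep _ (act-↭ (gen b) (↭-trans (↭-reflexive-≋ (inversions-++ z [ b ])) (++⁺ʳ _ p))) ⟩
    gen b ∷ act (gen b) ((t ∷ B ++ act t B) ++ act (prod z) [ gen b ])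
      ↭R.≡⟨ (≡.trans (≡.cong (gen b ∷_) (List.map-++ (conj (gen b)) (t ∷ B ++ act t B) _))
         (≡.cong (λ l → gen b ∷ (conj (gen b) t ∷ l) ++ act (gen b) (act (prod z) [ gen b ]))
           (List.map-++ (conj (gen b)) B (act t B)))) ⟩
    gen b ∷ (conj (gen b) t ∷ act (gen b) B ++ act (gen b) (act t B)) ++ [ conj (gen b) (conj (prod z) (gen b)) ]
      ↭R.↭⟨ solve 5 (λ x y B C z → x ⊕ (y ⊕ B ⊕ C) ⊕ z ⊜ y ⊕ (x ⊕ B) ⊕ z ⊕ C) ↭-refl
         [ gen b ] [ conj (gen b) t ] (act (gen b) B) (act (gen b) (act t B)) [ conj (gen b) (conj (prod z) (gen b)) ] ⟩
    conj (gen b) t ∷ (gen b ∷ act (gen b) B) ++ conj (gen b) (conj (prod z) (gen b)) ∷ act (gen b) (act t B)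
      ↭R.↭⟨ prep (sym (conj-∙ _ _ _)) (++⁺ˡ (gen b ∷ act (gen b) B)
         (prep last (↭-reflexive-≋ (≋-trans (≋-sym (act-∙ _ _ B)) (≋-trans (act-cong swapped B) (act-∙ _ _ B)))))) ⟩
    t′ ∷ (gen b ∷ act (gen b) B) ++ act t′ (gen b ∷ act (gen b) B) ↭R.∎)
    where
    z = reflectionWord us a
    t = conj (prod us) (gen a)
    t′ = conj (prod (b ∷ us)) (gen a)
    swapped : gen b ∙ t ≈ t′ ∙ gen b
    swapped = sym (trans (∙-congʳ (conj-∙ _ _ _)) (conj-commute _ _))
    last : conj (gen b) (conj (prod z) (gen b)) ≈ conj t′ (gen b)
    last = begin
      conj (gen b) (conj (prod z) (gen b)) ≈⟨ conj-cong _ (conj-cong₂ (prod-reflectionWord us a) refl) ⟩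
      conj (gen b) (conj t (gen b))        ≈⟨ conj-∙ _ _ _ ⟨
      conj (gen b ∙ t) (gen b)             ≈⟨ conj-cong₂ swapped refl ⟩
      conj (t′ ∙ gen b) (gen b)            ≈⟨ conj-∙ _ _ _ ⟩
      conj t′ (conj (gen b) (gen b))       ≈⟨ conj-cong _ (conj-self _) ⟩
      conj t′ (gen b)                      ∎

  -- Alternately follow the matching and the involution x ↦ t x t on B ++ act t B.
  -- The walk starting at the partner of t can only end in K.
  walk : ∀ {t} → t ∙ t ≈ ε → ∀ n K B → length B ≤ n → Paired (t ∷ K ++ B ++ act t B) → t ∈ K
  walk {t} t² n K B B≤n p with partner p ↭-refl
  ... | k , q , r with Membershipₚ.∈-++⁻ setoid K (∈-resp-↭ (↭-sym q) (here refl))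
  ... | inj₁ t∈K = t∈K
  ... | inj₂ t∈BB = step n B≤n
    where
    -- Conjugation by `t` fixes `t`, so `t` occurs in both `B` and `act t B` as soon as it occurs in
    -- one. One copy is the partner of the head, the other becomes the new head, and `B` loses an
    -- entry.
    t∈B : t ∈ B
    t∈B = [ (λ t∈ → t∈) , (λ t∈ → ∈-act⁻ (Membershipₚ.∈-resp-≈ setoid (sym (conj-self t)) t∈)) ]′
            (Membershipₚ.∈-++⁻ setoid B t∈BB)
    B′ = proj₁ (∈⇒↭ t∈B)
    B↭ : B ↭ t ∷ B′
    B↭ = proj₂ (∈⇒↭ t∈B)
    rest : k ↭ t ∷ K ++ B′ ++ act t B′
    rest = drop-∷ (↭-trans (↭-sym q) (↭-trans
      (++⁺ˡ K (++⁺ B↭ (↭-trans (act-↭ t B↭) (prep (conj-self t) ↭-refl))))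
      (solve 4 (λ t K B C → K ⊕ (t ⊕ B) ⊕ t ⊕ C ⊜ t ⊕ t ⊕ K ⊕ B ⊕ C) ↭-refl [ t ] K B′ (act t B′))))
    step : ∀ n → length B ≤ n → t ∈ K
    step n |B|≤n with xs↭ys⇒|xs|≡|ys| B↭
    step zero |B|≤n | eq with () ← ≡.subst (_≤ zero) eq |B|≤n
    step (suc n) |B|≤n | eq =
      walk t² n K B′ (ℕ.≤-pred (≡.subst (_≤ suc n) eq |B|≤n)) (Paired-resp-↭ rest r)

-- Reduced words and lengths.

module ChainProperties {c ℓ i : Level} (CS : CoxeterSystem c ℓ i) where
  open CoxeterSystem CS
  open CoxeterNotions CS
  open Group W
  open GroupProperties W using (⁻¹-anti-homo-∙; ⁻¹-involutive; ∙-cancelˡ; ε⁻¹≈ε)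
  open SignedGroup W
  open Inversions CS
  open SetoidReasoning setoid

  record Reduced (ws : List I) : Set (ℓ ⊔ i) where
    constructor reduced
    field
      shortest : ∀ vs → prod vs ≈ prod ws → length ws ≤ length vs
  open Reduced

  Reduced-resp : ∀ {us vs} → prod vs ≈ prod us → length vs ≤ length us → Reduced us → Reduced vs
  Reduced-resp p vs≤us r = reduced λ ws q → ℕ.≤-trans vs≤us (shortest r ws (trans q p))

  Reduced-prefix : ∀ us {vs} → Reduced (us ++ vs) → Reduced us
  Reduced-prefix us {vs} r = reduced λ ws p → ℕ.+-cancelʳ-≤ (length vs) _ _
    (≡.subst₂ _≤_ (List.length-++ us) (List.length-++ ws)
      (shortest r (ws ++ vs) (trans (prod-++ ws vs) (trans (∙-congʳ p) (sym (prod-++ us vs))))))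

  Reduced-suffix : ∀ us {vs} → Reduced (us ++ vs) → Reduced vs
  Reduced-suffix us {vs} r = reduced λ ws p → ℕ.+-cancelˡ-≤ (length us) _ _
    (≡.subst₂ _≤_ (List.length-++ us) (List.length-++ us)
      (shortest r (us ++ ws) (trans (prod-++ us ws) (trans (∙-congˡ p) (sym (prod-++ us vs))))))

  Reduced⇒Len : ∀ {w} ws → Reduced ws → prod ws ≈ w → Len w (length ws)
  Reduced⇒Len ws r p = (ws , p , ≡.refl) , λ vs q → shortest r vs (trans q (sym p))

  Len⇒Reduced : ∀ {w n} → Len w n → ∃ λ ws → prod ws ≈ w × length ws ≡ n × Reduced ws
  Len⇒Reduced ((ws , p , ≡.refl) , min) = ws , p , ≡.refl , reduced λ vs q → min vs (trans q p)

  Len-cong : ∀ {v w n} → v ≈ w → Len v n → Len w n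
  Len-cong v≈w ((ws , p , eq) , min) = (ws , trans p v≈w , eq) , λ vs q → min vs (trans q (sym v≈w))

  Len-unique : ∀ {w m n} → Len w m → Len w n → m ≡ n
  Len-unique ((ws , p , ≡.refl) , min) ((ws′ , p′ , ≡.refl) , min′) =
    ℕ.≤-antisym (min ws′ p′) (min′ ws p)

  prod-reverse : ∀ ws → prod (reverse ws) ≈ prod ws ⁻¹
  prod-reverse [] = sym ε⁻¹≈ε
  prod-reverse (a ∷ ws) = begin
    prod (reverse (a ∷ ws))             ≡⟨ ≡.cong prod (List.unfold-reverse a ws) ⟩
    prod (reverse ws ++ [ a ])          ≈⟨ prod-++ (reverse ws) [ a ] ⟩
    prod (reverse ws) ∙ (gen a ∙ ε)     ≈⟨ ∙-cong (prod-reverse ws) (trans (identityʳ _) (sym (gen⁻¹ a))) ⟩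
    prod ws ⁻¹ ∙ gen a ⁻¹               ≈⟨ ⁻¹-anti-homo-∙ _ _ ⟨
    (gen a ∙ prod ws) ⁻¹                ∎

  Len-⁻¹ : ∀ {w n} → Len w n → Len (w ⁻¹) n
  Len-⁻¹ ((ws , p , eq) , min) =
    (reverse ws , trans (prod-reverse ws) (⁻¹-cong p) , ≡.trans (List.length-reverse ws) eq) ,
    λ vs q → ≡.subst (_ ≤_) (List.length-reverse vs)
      (min (reverse vs) (trans (prod-reverse vs) (trans (⁻¹-cong q) (⁻¹-involutive _))))

  -- Reduced subwords and strong exchange.

  shorter-subword : ∀ us vs → length us < length vs → prod us ≈ prod vs →
    ∃ λ ws → ws ⊆ vs × length vs ≡ suc (suc (length ws)) × prod ws ≈ prod vs
  shorter-subword us vs us<vs p = double-deletion vs (proj₂ (proj₂ repeated))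
    where
    -- `vs` has more inversions than `us`, so some two inversions of `vs` are matched to each other.
    repeated = pigeonhole _ (inversions vs) (inversions us) ℕ.≤-refl
      (≡.subst₂ _<_ (≡.sym (length-inversions us)) (≡.sym (length-inversions vs)) us<vs)
      (inversions-unique vs us (sym p))

  -- Strong exchange yields subwords that need not be reduced. Letters are removed two at a time
  -- until the length reaches that of `us`, below which it cannot fall.
  reduced-subword : ∀ n us vs → length vs ≤ n → Reduced us → prod us ≈ prod vs →
    ∃ λ ws → ws ⊆ vs × prod ws ≈ prod vs × length ws ≡ length us
  reduced-subword n us vs vs≤n r p = by-length (length vs ℕ.≤? length us)
    where
    shorten : ∀ n → length vs ≤ n →
      (∃ λ ws → ws ⊆ vs × length vs ≡ suc (suc (length ws)) × prod ws ≈ prod vs) →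
      ∃ λ ws → ws ⊆ vs × prod ws ≈ prod vs × length ws ≡ length us
    shorten zero vs≤n (_ , _ , eq , _) with () ← ≡.subst (_≤ zero) eq vs≤n
    shorten (suc n) vs≤n (ws , ws⊆vs , eq , q)
      with reduced-subword n us ws (ℕ.<⇒≤ (ℕ.≤-pred (≡.subst (_≤ suc n) eq vs≤n))) r (trans p (sym q))
    ... | ws′ , ws′⊆ws , q′ , eq′ = ws′ , ⊆-trans ws′⊆ws ws⊆vs , trans q′ q , eq′
    by-length : Dec (length vs ≤ length us) →
      ∃ λ ws → ws ⊆ vs × prod ws ≈ prod vs × length ws ≡ length us
    by-length (yes vs≤us) = vs , ⊆-refl , refl , ℕ.≤-antisym vs≤us (shortest r vs (sym p))
    by-length (no vs≰us) = shorten n vs≤n (shorter-subword us vs (ℕ.≰⇒> vs≰us) p)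

  -- Write `w` as τ x with τ = x t x⁻¹, and compare the inversions of `ws` with those of a
  -- palindrome for τ followed by a reduced word of `x`. The palindrome contributes τ and pairs
  -- swapped by conjugation with τ, so by `walk` τ is an inversion of `ws` or comes from `x`; the
  -- latter contradicts the lengths.
  strong-exchange : ∀ {x w} → Arrow x w → ∀ ws → prod ws ≈ w → ∃ λ vs → vs ⊆ ws × prod vs ≈ x
  strong-exchange {x} {w} (t , (g , a , t≈) , w≈xt , _ , _ , lenx , lenw , x<w) ws ws≈w
    -- A word for `x ∙ g` turns the right factor `t` into the left factor x t x⁻¹ and spells it as a
    -- palindrome.
    with generated (x ∙ g) | Len⇒Reduced lenx
  ... | us , us≈xg | xs , xs≈x , ≡.refl , _ = [ in-ws , in-xs ]′ (Membershipₚ.∈-++⁻ setoid (inversions ws) τ∈)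
    where
    τ = conj (prod us) (gen a)
    z = reflectionWord us a
    τ² : τ ∙ τ ≈ ε
    τ² = conj-square (prod us) (gen-square a)
    τx≈w : τ ∙ x ≈ w
    τx≈w = begin
      τ ∙ x                    ≈⟨ ∙-congʳ (conj-cong₂ us≈xg refl) ⟩
      conj (x ∙ g) (gen a) ∙ x ≈⟨ ∙-congʳ (conj-∙ _ _ _) ⟩
      conj x (conj g (gen a)) ∙ x ≈⟨ ∙-congʳ (conj-cong x t≈) ⟨
      conj x t ∙ x             ≈⟨ conj-commute x t ⟩
      x ∙ t                    ≈⟨ w≈xt ⟨
      w                        ∎
    τw≈x : τ ∙ w ≈ x
    τw≈x = begin
      τ ∙ w        ≈⟨ ∙-congˡ τx≈w ⟨
      τ ∙ (τ ∙ x)  ≈⟨ assoc _ _ _ ⟨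
      τ ∙ τ ∙ x    ≈⟨ ∙-congʳ τ² ⟩
      ε ∙ x        ≈⟨ identityˡ x ⟩
      x            ∎
    ws≈zxs : prod ws ≈ prod (z ++ xs)
    ws≈zxs = begin
      prod ws          ≈⟨ ws≈w ⟩
      w                ≈⟨ τx≈w ⟨
      τ ∙ x            ≈⟨ ∙-cong (prod-reflectionWord us a) xs≈x ⟨
      prod z ∙ prod xs ≈⟨ prod-++ z xs ⟨
      prod (z ++ xs)   ∎
    B = proj₁ (inversions-reflectionWord us a)
    X = act (prod z) (inversions xs)
    τ∈ : τ ∈ inversions ws ++ X
    τ∈ = walk τ² (length B) (inversions ws ++ X) B ℕ.≤-refl
      (Paired-resp-↭
        (↭-trans (++⁺ˡ (inversions ws) (↭-trans (↭-reflexive-≋ (inversions-++ z xs))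
                   (++⁺ʳ X (proj₂ (inversions-reflectionWord us a)))))
          (solve 5 (λ l t B C X → l ⊕ (t ⊕ B ⊕ C) ⊕ X ⊜ t ⊕ (l ⊕ X) ⊕ B ⊕ C) ↭-refl
            (inversions ws) [ τ ] B (act τ B) X))
        (inversions-unique ws (z ++ xs) ws≈zxs))
    in-ws : τ ∈ inversions ws → ∃ λ vs → vs ⊆ ws × prod vs ≈ x
    in-ws τ∈ws with deletion ws τ∈ws
    ... | vs , vs⊆ws , _ , p = vs , vs⊆ws , trans p (trans (∙-congˡ ws≈w) τw≈x)
    -- As τ commutes with itself, it is an inversion of `xs`; deleting its letter spells τ x = `w`
    -- with fewer letters than `x` has, against l(x) < l(w).
    in-xs : τ ∈ X → ∃ λ vs → vs ⊆ ws × prod vs ≈ x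
    in-xs τ∈X with deletion xs (∈-act⁻ (Membershipₚ.∈-resp-≈ setoid
      (sym (trans (conj-cong₂ (prod-reflectionWord us a) refl) (conj-self τ))) τ∈X))
    ... | vs , _ , eq , p = ⊥-elim (ℕ.<-irrefl ≡.refl (ℕ.<-trans x<w
      (ℕ.≤-<-trans (proj₂ lenw vs (trans p (trans (∙-congˡ xs≈x) τx≈w)))
        (ℕ.≤-reflexive (≡.sym eq)))))

  -- Half of the subword property: each arrow, taken from the top down, is one strong exchange.
  ≤B⇒subword : ∀ {v w} → v ≤B w → ∀ ws → prod ws ≈ w → ∃ λ vs → vs ⊆ ws × prod vs ≈ v
  ≤B⇒subword (≤B-refl v≈w) ws p = ws , ⊆-refl , trans p (sym v≈w)
  ≤B⇒subword (≤B-step v→x x≤w) ws p with ≤B⇒subword x≤w ws p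
  ... | xs , xs⊆ws , q with strong-exchange v→x xs q
  ... | vs , vs⊆xs , r = vs , ⊆-trans vs⊆xs xs⊆ws , r

  -- Strong covers with an explicit reflection.

  Cover : Carrier → Carrier → Set (c ⊔ ℓ ⊔ i)
  Cover x y = ∃ λ n → Len x n × Len y (suc n) × ∃ λ t → IsReflection t × y ≈ x ∙ t

  Cover-resp : ∀ {x x′ y y′} → x ≈ x′ → y ≈ y′ → Cover x y → Cover x′ y′
  Cover-resp p q (n , lenx , leny , t , t-refl , y≈) =
    n , Len-cong p lenx , Len-cong q leny , t , t-refl , trans (sym q) (trans y≈ (∙-congʳ p))

  Cover⇒⋖ : ∀ {x y} → Cover x y → x ⋖ y
  Cover⇒⋖ (n , lenx , leny , t , t-refl , y≈) =
    ≤B-step (t , t-refl , y≈ , n , suc n , lenx , leny , ℕ.n<1+n n) (≤B-refl refl) ,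
    (λ x≈y → ℕ.1+n≢n (≡.sym (Len-unique (Len-cong x≈y lenx) leny))) ,
    n , lenx , leny

  conj-reflection : ∀ g {t} → IsReflection t → IsReflection (conj g t)
  conj-reflection g (h , a , t≈) = g ∙ h , a , trans (conj-cong g t≈) (sym (conj-∙ g h (gen a)))

  reflection⁻¹ : ∀ {t} → IsReflection t → t ⁻¹ ≈ t
  reflection⁻¹ {t} (g , a , t≈) = begin
    t ⁻¹                         ≈⟨ identityʳ _ ⟨
    t ⁻¹ ∙ ε                     ≈⟨ ∙-congˡ (trans (∙-cong t≈ t≈) (conj-square g (gen-square a))) ⟨
    t ⁻¹ ∙ (t ∙ t)               ≈⟨ assoc _ _ _ ⟨
    t ⁻¹ ∙ t ∙ t                 ≈⟨ ∙-congʳ (inverseˡ t) ⟩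
    ε ∙ t                        ≈⟨ identityˡ t ⟩
    t                            ∎

  -- Inversion turns the right factor `t` into a left factor; conjugating by `x` moves it back to
  -- the right.
  ⁻¹-reflection : ∀ {x y t} → IsReflection t → y ≈ x ∙ t →
    ∃ λ s → IsReflection s × y ⁻¹ ≈ x ⁻¹ ∙ s
  ⁻¹-reflection {x} {y} {t} t-refl y≈ = conj x t , conj-reflection x t-refl , (begin
    y ⁻¹                     ≈⟨ ⁻¹-cong y≈ ⟩
    (x ∙ t) ⁻¹               ≈⟨ ⁻¹-anti-homo-∙ x t ⟩
    t ⁻¹ ∙ x ⁻¹              ≈⟨ ∙-congʳ (reflection⁻¹ t-refl) ⟩
    t ∙ x ⁻¹                 ≈⟨ ∙-congʳ (conj-inverseˡ x t) ⟨
    conj (x ⁻¹) (conj x t) ∙ x ⁻¹ ≈⟨ conj-commute (x ⁻¹) (conj x t) ⟩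
    x ⁻¹ ∙ conj x t          ∎)

  Cover-⁻¹ : ∀ {x y} → Cover x y → Cover (x ⁻¹) (y ⁻¹)
  Cover-⁻¹ (n , lenx , leny , t , t-refl , y≈) =
    n , Len-⁻¹ lenx , Len-⁻¹ leny , ⁻¹-reflection t-refl y≈

  ≤B-⁻¹ : ∀ {v w} → v ≤B w → (v ⁻¹) ≤B (w ⁻¹)
  ≤B-⁻¹ (≤B-refl v≈w) = ≤B-refl (⁻¹-cong v≈w)
  ≤B-⁻¹ (≤B-step (t , t-refl , x≈ , m , n , lenv , lenx , m<n) x≤w)
    with ⁻¹-reflection t-refl x≈
  ... | s , s-refl , x⁻¹≈ =
    ≤B-step (s , s-refl , x⁻¹≈ , m , n , Len-⁻¹ lenv , Len-⁻¹ lenx , m<n) (≤B-⁻¹ x≤w)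

  -- Chains of covers.

  Chain : ∀ {p} → (Carrier → Set p) → Carrier → Carrier → Set (c ⊔ ℓ ⊔ i ⊔ p)
  Chain P v w = ∃ λ (n : ℕ) → ∃ λ (x : ℕ → Carrier) →
    x 0 ≈ v × x n ≈ w × (∀ k → k < n → Cover (x k) (x (suc k))) × (∀ k → k ≤ n → P (x k))

  Chain-resp : ∀ {p} {P : Carrier → Set p} {v v′ w w′} → v ≈ v′ → w ≈ w′ → Chain P v w → Chain P v′ w′
  Chain-resp v≈ w≈ (n , x , x0 , xn , cov , mem) = n , x , trans x0 v≈ , trans xn w≈ , cov , mem

  -- Covers have to be preserved between members of `P` only: left multiplication by a generator
  -- raises lengths by one on suitable prefixes, but not on the whole group.
  Chain-map : ∀ {p q} {P : Carrier → Set p} {Q : Carrier → Set q} (f : Carrier → Carrier) →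
    (∀ {x y} → x ≈ y → f x ≈ f y) → (∀ {x} → P x → Q (f x)) →
    (∀ {x y} → P x → P y → Cover x y → Cover (f x) (f y)) →
    ∀ {v w} → Chain P v w → Chain Q (f v) (f w)
  Chain-map f f-cong P⇒Q f-cover (n , x , x0 , xn , cov , mem) =
    n , (λ k → f (x k)) , f-cong x0 , f-cong xn ,
    (λ k k<n → f-cover (mem k (ℕ.<⇒≤ k<n)) (mem (suc k) k<n) (cov k k<n)) ,
    (λ k k≤n → P⇒Q (mem k k≤n))

  Chain-∷ : ∀ {p} {P : Carrier → Set p} {v x w} → P v → Cover v x → Chain P x w → Chain P v w
  Chain-∷ {P = P} {v} Pv v⋖x (n , xs , x0 , xn , cov , mem) = suc n , ys , refl , xn , cov′ , mem′
    where
    ys : ℕ → Carrier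
    ys zero    = v
    ys (suc k) = xs k
    cov′ : ∀ k → k < suc n → Cover (ys k) (ys (suc k))
    cov′ zero    _         = Cover-resp refl (sym x0) v⋖x
    cov′ (suc k) (s≤s k<n) = cov k k<n
    mem′ : ∀ k → k ≤ suc n → P (ys k)
    mem′ zero    _         = Pv
    mem′ (suc k) (s≤s k≤n) = mem k k≤n

  -- The right weak order in reduced words.

  Prefix : Carrier → Carrier → Set (ℓ ⊔ i)
  Prefix u x = ∃ λ p → ∃ λ q → Reduced (p ++ q) × prod p ≈ x × prod (p ++ q) ≈ u

  module _ {s us} (r : Reduced (s ∷ us)) where
    -- A reduced word for `prod us` is at most as long as `us`, so with `s` in front it is at most
    -- as long as the reduced word `s ∷ us` of the same element.
    Reduced-extend : ∀ p q → Reduced (p ++ q) → prod (p ++ q) ≈ prod us → Reduced (s ∷ p ++ q)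
    Reduced-extend p q r′ eq = Reduced-resp (∙-congˡ eq) (s≤s (shortest r′ us (sym eq))) r

    Prefix-extend : ∀ {x} → Prefix (prod us) x → Prefix (prod (s ∷ us)) (gen s ∙ x)
    Prefix-extend (p , q , r′ , p≈x , eq) =
      s ∷ p , q , Reduced-extend p q r′ eq , ∙-congˡ p≈x , ∙-congˡ eq

    Len-extend : ∀ {x n} → Prefix (prod us) x → Len x n → Len (gen s ∙ x) (suc n)
    Len-extend (p , q , r′ , p≈x , eq) lenx
      rewrite Len-unique lenx (Reduced⇒Len p (Reduced-prefix p r′) p≈x) =
      Reduced⇒Len (s ∷ p) (Reduced-prefix (s ∷ p) (Reduced-extend p q r′ eq)) (∙-congˡ p≈x)

    Chain-extend : ∀ {v w} → Chain (Prefix (prod us)) v w →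
      Chain (Prefix (prod (s ∷ us))) (gen s ∙ v) (gen s ∙ w)
    Chain-extend = Chain-map {P = Prefix (prod us)} {Q = Prefix (prod (s ∷ us))} (gen s ∙_) ∙-congˡ Prefix-extend
      -- A cover names its reflection as a right factor, which left multiplication leaves unchanged.
      λ { px py (n , lenx , leny , t , t-refl , y≈) →
          suc n , Len-extend px lenx , Len-extend py leny ,
          t , t-refl , trans (∙-congˡ y≈) (sym (assoc _ _ _)) }

  ++-cong-prefix : ∀ {us vs} qs → prod us ≈ prod vs → prod (us ++ qs) ≈ prod (vs ++ qs)
  ++-cong-prefix {us} {vs} qs p =
    trans (prod-++ us qs) (trans (∙-congʳ p) (sym (prod-++ vs qs)))

  -- Both factorisations have product u. Whenever `ws` is nonempty, its first letter `s` is taken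
  -- off `ws` and off u: the recursion chains between prefixes of s u, and left multiplication by
  -- `s` carries the chain back. The tail `qv` varies because `ascent` shortens it.
  subword-chain : ∀ ws {vs} qv qw → vs ⊆ ws → Reduced (vs ++ qv) → Reduced (ws ++ qw) →
    prod (vs ++ qv) ≈ prod (ws ++ qw) → Chain (Prefix (prod (ws ++ qw))) (prod vs) (prod ws)
  subword-chain [] qv qw [] rv rw eq = 0 , (λ _ → ε) , refl , refl , (λ _ ()) ,
    λ _ _ → [] , qw , rw , refl , refl
  subword-chain (s ∷ ws) qv qw (≡.refl ∷ vs⊆ws) rv rw eq =
    Chain-extend rw (subword-chain ws qv qw vs⊆ws (Reduced-suffix [ s ] rv) (Reduced-suffix [ s ] rw)
      (∙-cancelˡ _ _ _ eq))
  subword-chain (s ∷ ws) {vs} qv qw (_ ∷ʳ vs⊆ws) rv rw eq =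
    -- The inversion `gen s` heads the list of `s ∷ ws ++ qw`; its partner lies further on in that
    -- list or among the inversions of `vs ++ qv`.
    by-partner (partner (inversions-unique (s ∷ ws ++ qw) (vs ++ qv) (sym eq)) ↭-refl)
    where
    Goal = Chain (Prefix (prod (s ∷ ws ++ qw))) (prod vs) (prod (s ∷ ws))

    su≈ : gen s ∙ prod (vs ++ qv) ≈ prod (ws ++ qw)
    su≈ = trans (∙-congˡ eq) (gen-cancel s _)

    -- Deleting the letter of the repeated inversion from `ws ++ qw` would spell u with two letters
    -- fewer than the reduced word `s ∷ ws ++ qw`.
    head-repeated : gen s ∈ act (gen s) (inversions (ws ++ qw)) → Goal
    head-repeated s∈ with deletion (ws ++ qw) (∈-act⁻ (Membershipₚ.∈-resp-≈ setoid (sym (conj-self (gen s))) s∈))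
    ... | us , _ , len , p = ⊥-elim (ℕ.<-irrefl ≡.refl
      (ℕ.<-≤-trans (≡.subst (length us <_) (≡.sym (≡.cong suc len)) (ℕ.m<n⇒m<1+n (ℕ.n<1+n _))) (shortest rw us p)))

    -- Deleting that letter leaves a word `vs′` for s v that is still a subword of `ws`. The reduced
    -- word `s ∷ vs′` replaces `vs`, and `s` cancels as in the previous clause.
    descent : gen s ∈ inversions vs → Goal
    descent s∈ with deletion vs s∈
    ... | vs′ , vs′⊆vs , len , p = Chain-resp {P = Prefix (prod (s ∷ ws ++ qw))} s∙vs′≈vs refl
      (Chain-extend rw (subword-chain ws qv qw (⊆-trans vs′⊆vs vs⊆ws) (Reduced-suffix [ s ] rv′)
        (Reduced-suffix [ s ] rw) (trans (++-cong-prefix {vs′} {s ∷ vs} qv p) su≈)))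
      where
      s∙vs′≈vs : prod (s ∷ vs′) ≈ prod vs
      s∙vs′≈vs = trans (∙-congˡ p) (gen-cancel s _)
      rv′ : Reduced (s ∷ vs′ ++ qv)
      rv′ = Reduced-resp (++-cong-prefix {s ∷ vs′} {vs} qv s∙vs′≈vs)
        (ℕ.≤-reflexive (≡.trans (List.length-++ (s ∷ vs′))
          (≡.trans (≡.cong (_+ length qv) (≡.sym len)) (≡.sym (List.length-++ vs))))) rv

    -- Here s = v t v⁻¹ for an inversion `t` of `qv`. Deleting its letter gives v q′ = s u, so
    -- `s ∷ vs ++ q′` spells u with as many letters as `vs ++ qv` and is reduced.
    ascent : gen s ∈ act (prod vs) (inversions qv) → Goal
    ascent s∈ with Membershipₚ.∈-map⁻ setoid setoid s∈
    ... | t , t∈ , s≈ with deletion qv t∈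
    ... | q′ , _ , len , p = Chain-∷ {P = Prefix (prod (s ∷ ws ++ qw))} (vs , qv , rv , refl , eq)
      (length vs , Reduced⇒Len vs (Reduced-prefix vs rv) refl ,
        Reduced⇒Len (s ∷ vs) (Reduced-prefix (s ∷ vs) rv′) refl ,
        -- Left multiplication of v by s is right multiplication by v⁻¹ s v.
        conj (prod vs ⁻¹) (gen s) , (prod vs ⁻¹ , s , refl) , s∙vs≈)
      (Chain-extend rw (subword-chain ws q′ qw vs⊆ws (Reduced-suffix [ s ] rv′)
        (Reduced-suffix [ s ] rw) vs++q′≈))
      where
      vs++q′≈ : prod (vs ++ q′) ≈ prod (ws ++ qw)
      vs++q′≈ = begin
        prod (vs ++ q′)                        ≈⟨ prod-++ vs q′ ⟩
        prod vs ∙ prod q′                      ≈⟨ ∙-congˡ p ⟩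
        prod vs ∙ (t ∙ prod qv)                ≈⟨ conj-commute-∙ _ _ _ ⟨
        conj (prod vs) t ∙ (prod vs ∙ prod qv) ≈⟨ ∙-cong (sym s≈) (sym (prod-++ vs qv)) ⟩
        gen s ∙ prod (vs ++ qv)                ≈⟨ su≈ ⟩
        prod (ws ++ qw)                        ∎
      rv′ : Reduced (s ∷ vs ++ q′)
      rv′ = Reduced-resp (trans (∙-congˡ vs++q′≈) (sym eq))
        (ℕ.≤-reflexive (≡.trans (≡.cong suc (List.length-++ vs)) (≡.trans (≡.sym (ℕ.+-suc _ _))
          (≡.trans (≡.cong (length vs +_) (≡.sym len)) (≡.sym (List.length-++ vs)))))) rv
      s∙vs≈ : gen s ∙ prod vs ≈ prod vs ∙ conj (prod vs ⁻¹) (gen s)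
      s∙vs≈ = begin
        gen s ∙ prod vs ≈⟨ ∙-congʳ (trans (sym (conj-ε _)) (trans (conj-cong₂ (sym (inverseʳ _)) refl) (conj-∙ _ _ _))) ⟩
        conj (prod vs) (conj (prod vs ⁻¹) (gen s)) ∙ prod vs ≈⟨ conj-commute _ _ ⟩
        prod vs ∙ conj (prod vs ⁻¹) (gen s) ∎

    by-partner : _ → Goal
    by-partner (k , q , _) with Membershipₚ.∈-++⁻ setoid (act (gen s) (inversions (ws ++ qw)))
                                  (∈-resp-↭ (↭-sym q) (here refl))
    ... | inj₁ s∈ = head-repeated s∈
    ... | inj₂ s∈ = [ descent , ascent ]′ (Membershipₚ.∈-++⁻ setoid (inversions vs)
                      (∈-resp-↭ (↭-reflexive-≋ (inversions-++ vs qv)) s∈))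

  -- From reduced words to weak intervals.

  ≤R⇒Prefix : ∀ {x u} → x ≤R u → Prefix u x
  ≤R⇒Prefix {x} {u} (_ , _ , _ , ((p , p≈ , ≡.refl) , _) , ((q , q≈ , ≡.refl) , _) , (_ , min) , ≡.refl) =
    -- The lengths of `x` and x⁻¹ u add up to that of `u`, so no word for `u` is shorter than
    -- `p ++ q`.
    p , q , (reduced λ vs eq → ≡.subst (_≤ length vs) (≡.sym (List.length-++ p)) (min vs (trans eq pq≈))) , p≈ , pq≈
    where
    pq≈ : prod (p ++ q) ≈ u
    pq≈ = begin
      prod (p ++ q)    ≈⟨ prod-++ p q ⟩
      prod p ∙ prod q  ≈⟨ ∙-cong p≈ q≈ ⟩
      x ∙ (x ⁻¹ ∙ u)   ≈⟨ assoc _ _ _ ⟨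
      x ∙ x ⁻¹ ∙ u     ≈⟨ ∙-congʳ (inverseʳ x) ⟩
      ε ∙ u            ≈⟨ identityˡ u ⟩
      u                ∎

  Prefix⇒≤R : ∀ {x u} → Prefix u x → x ≤R u
  Prefix⇒≤R {x} {u} (p , q , r , p≈ , pq≈) =
    _ , _ , _ , Reduced⇒Len p (Reduced-prefix p r) p≈ , Reduced⇒Len q (Reduced-suffix p r) q≈ ,
    Reduced⇒Len (p ++ q) r pq≈ , ≡.sym (List.length-++ p)
    where
    q≈ : prod q ≈ x ⁻¹ ∙ u
    q≈ = begin
      prod q                   ≈⟨ identityˡ _ ⟨
      ε ∙ prod q               ≈⟨ ∙-congʳ (inverseˡ x) ⟨
      x ⁻¹ ∙ x ∙ prod q        ≈⟨ assoc _ _ _ ⟩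
      x ⁻¹ ∙ (x ∙ prod q)      ≈⟨ ∙-congˡ (∙-congʳ p≈) ⟨
      x ⁻¹ ∙ (prod p ∙ prod q) ≈⟨ ∙-congˡ (trans (sym (prod-++ p q)) pq≈) ⟩
      x ⁻¹ ∙ u                 ∎

  chainR : ∀ {u v w} → v ≤R u → w ≤R u → v ≤B w → Chain (IntervalR u) v w
  chainR {u} v≤u w≤u v≤w with ≤R⇒Prefix v≤u | ≤R⇒Prefix w≤u
  ... | p , qv , rv , p≈v , pqv≈u | ws , qw , rw , ws≈w , wsqw≈u with ≤B⇒subword v≤w ws ws≈w
  -- The subword `xs` spells `v` but may be too long. Cut to the length of `p`, it can replace `p`
  -- in the reduced word `p ++ qv` of `u`.
  ... | xs , xs⊆ws , xs≈v with reduced-subword _ p xs ℕ.≤-refl (Reduced-prefix p rv) (trans p≈v (sym xs≈v))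
  ... | vs , vs⊆xs , vs≈xs , len =
    Chain-resp {P = IntervalR u} (trans vs≈xs xs≈v) ws≈w
      (Chain-map {P = Prefix (prod (ws ++ qw))} {Q = IntervalR u} (λ x → x) (λ x≈y → x≈y)
      (λ { (p , q , r , p≈ , pq≈) → Prefix⇒≤R (p , q , r , p≈ , trans pq≈ wsqw≈u) })
      (λ _ _ x⋖y → x⋖y)
      (subword-chain ws qv qw (⊆-trans vs⊆xs xs⊆ws)
        (Reduced-resp vsqv≈ (ℕ.≤-reflexive
          (≡.trans (List.length-++ vs) (≡.trans (≡.cong (_+ length qv) len) (≡.sym (List.length-++ p))))) rv)
        rw (trans vsqv≈ (trans pqv≈u (sym wsqw≈u)))))
    where
    vsqv≈ : prod (vs ++ qv) ≈ prod (p ++ qv)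
    vsqv≈ = ++-cong-prefix {vs} {p} qv (trans vs≈xs (trans xs≈v (sym p≈v)))

  ≤L⇒⁻¹≤R : ∀ {x u} → x ≤L u → (x ⁻¹) ≤R (u ⁻¹)
  ≤L⇒⁻¹≤R (a , b , d , lena , lenb , lend , eq) =
    b , a , d , Len-⁻¹ lenb , Len-cong (⁻¹-anti-homo-∙ _ _) (Len-⁻¹ lena) , Len-⁻¹ lend ,
    ≡.trans (ℕ.+-comm b a) eq

  ≤R⁻¹⇒⁻¹≤L : ∀ {x u} → x ≤R (u ⁻¹) → (x ⁻¹) ≤L u
  ≤R⁻¹⇒⁻¹≤L (a , b , d , lena , lenb , lend , eq) =
    b , a , d ,
    Len-cong (trans (⁻¹-anti-homo-∙ _ _) (∙-congʳ (⁻¹-involutive _))) (Len-⁻¹ lenb) , Len-⁻¹ lena ,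
    Len-cong (⁻¹-involutive _) (Len-⁻¹ lend) , ≡.trans (ℕ.+-comm b a) eq

  chainL : ∀ {u v w} → v ≤L u → w ≤L u → v ≤B w → Chain (IntervalL u) v w
  chainL {u} v≤u w≤u v≤w = Chain-resp {P = IntervalL u} (⁻¹-involutive _) (⁻¹-involutive _)
    (Chain-map {P = IntervalR (u ⁻¹)} {Q = IntervalL u} _⁻¹ ⁻¹-cong ≤R⁻¹⇒⁻¹≤L (λ _ _ → Cover-⁻¹)
      (chainR (≤L⇒⁻¹≤R v≤u) (≤L⇒⁻¹≤R w≤u) (≤B-⁻¹ v≤w)))

  Chain⇒ChainProperty : ∀ {p} {P : Carrier → Set p} →
    (∀ {v w} → P v → P w → v ≤B w → Chain P v w) → ChainProperty P
  Chain⇒ChainProperty {P = P} chain v w Pv Pw v≤w with chain Pv Pw v≤w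
  ... | n , x , x0 , xn , cov , mem = n , x , x0 , xn , (λ k k<n → Cover⇒⋖ (cov k k<n)) , mem

theorem3p16 : ∀ {c ℓ i : Level} (CS : CoxeterSystem c ℓ i) (u : Group.Carrier (CoxeterSystem.W CS)) → CoxeterNotions.ChainProperty CS (CoxeterNotions.IntervalL CS u) × CoxeterNotions.ChainProperty CS (CoxeterNotions.IntervalR CS u)
theorem3p16 CS u = Chain⇒ChainProperty {P = IntervalL u} chainL , Chain⇒ChainProperty {P = IntervalR u} chainR
  where
  open CoxeterNotions CS
  open ChainProperties CS
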